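{- Let $r\ge 1$ be an integer. For integers $n,k\ge 0$ let $C(n,k,r)$ be the number of compositions of $n$ into $k$ positive parts that have no run of length $\ge r$ (with $C(0,0,r)=1$ counting the empty composition). Then, as formal power series in $x,q$, \[\sum_{n,k\ge 0}C(n,k,r)\,x^nq^k=\frac{1}{1-\frac{xq}{1-x}+q^r\sum_{j\ge 1}\frac{x^{rj}(1-qx^j)}{1-q^rx^{rj}}}.\]
   Context: A composition of $n$ into $k$ parts is an ordered sequence $(a_1,\dots,a_k)$ of positive integers with $a_1+\dots+a_k=n$. A run in a composition is a maximal string of consecutive identical parts; its length is the number of parts in it. For example, $28=3+5+5+5+3+3+4$ has run lengths $1,3,2,1$. -}

module Defs where

open import Data.Integer as ℤ using (ℤ; +_; 0ℤ; 1ℤ)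
import Data.Integer.Properties as ℤ
open import Data.Integer.Tactic.RingSolver using (solve-∀)
open import Data.List using (List; []; _∷_; map; concat; length; filter; upTo; cartesianProductWith)
open import Data.List.Membership.Propositional using (_∈_)
open import Data.List.Membership.Propositional.Properties using (∈-filter⁺; ∈-filter⁻; ∈-map⁺; ∈-upTo⁺; ∈-cartesianProductWith⁺)
open import Data.List.NonEmpty as List⁺ using (List⁺; _∷_; toList)
open import Data.List.Properties using (∷-injective)
open import Data.List.Relation.Unary.All as All using (All; []; _∷_)
open import Data.List.Relation.Unary.Any using (Any; any?; here)
open import Data.List.Relation.Unary.Linked using (Linked; []; [-]; _∷_)
open import Data.List.Relation.Unary.Unique.Propositional using (Unique; []; _∷_)
import Data.List.Relation.Unary.Unique.Propositional.Properties as Unique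
open import Data.Nat as ℕ using (ℕ; zero; suc; _∸_; _≤_; _<_; _≥_; z≤n; s≤s)
open import Data.Nat.ListAction using (sum)
import Data.Nat.Properties as ℕ
open import Data.Product using (_×_; _,_; proj₂)
open import Function using (_∘_)
open import Relation.Binary.PropositionalEquality using (_≡_; _≢_; refl; sym; trans; cong; cong₂; module ≡-Reasoning)
open import Relation.Nullary using (¬_; Dec; yes; no)
open import Relation.Nullary.Decidable using (_×-dec_; ¬?)

------------------------------------------------------------------------
-- Compositions and their runs

IsComposition : ℕ → ℕ → List ℕ → Set
IsComposition n k as = All (_≥ 1) as × length as ≡ k × sum as ≡ n

isComposition? : ∀ n k as → Dec (IsComposition n k as)
isComposition? n k as = All.all? (ℕ._≥? 1) as ×-dec (length as ℕ.≟ k) ×-dec (sum as ℕ.≟ n)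

consRun : ℕ → List (List⁺ ℕ) → List (List⁺ ℕ)
consRun a []              = (a ∷ []) ∷ []
consRun a ((b ∷ bs) ∷ ss) with a ℕ.≟ b
... | yes _ = (a ∷ b ∷ bs) ∷ ss
... | no  _ = (a ∷ []) ∷ (b ∷ bs) ∷ ss

-- The decomposition into maximal blocks of consecutive identical parts;
-- it is characterised by runs-concat, runs-constant and runs-maximal.
runs : List ℕ → List (List⁺ ℕ)
runs []       = []
runs (a ∷ as) = consRun a (runs as)

HasRun≥ : ℕ → List ℕ → Set
HasRun≥ r as = Any (λ s → List⁺.length s ≥ r) (runs as)

hasRun≥? : ∀ r as → Dec (HasRun≥ r as)
hasRun≥? r as = any? (λ s → List⁺.length s ℕ.≥? r) (runs as)

words : ℕ → List ℕ → List (List ℕ)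
words zero    ps = [] ∷ []
words (suc k) ps = cartesianProductWith _∷_ ps (words k ps)

-- The parts of a composition of n lie in {1,…,n}, so it suffices to
-- search the words over that alphabet (see ∈-runRestricted⁺).
runRestricted : ℕ → ℕ → ℕ → List (List ℕ)
runRestricted n k r =
  filter (λ as → isComposition? n k as ×-dec ¬? (hasRun≥? r as)) (words k (map suc (upTo n)))

C : ℕ → ℕ → ℕ → ℕ
C n k r = length (runRestricted n k r)

------------------------------------------------------------------------
-- Formal power series in x and q over ℤ: F n k is the coefficient of xⁿqᵏ

Series : Set
Series = ℕ → ℕ → ℤ

infix  4 _≈_
infixl 6 _+_ _-_
infixl 7 _*_ _/_
infixr 8 _^_

_≈_ : Series → Series → Set
F ≈ G = ∀ n k → F n k ≡ G n k

-- f 0 + … + f n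
sumTo : ℕ → (ℕ → ℤ) → ℤ
sumTo zero    f = f 0
sumTo (suc n) f = sumTo n f ℤ.+ f (suc n)

one x q : Series
one 0 0 = 1ℤ
one _ _ = 0ℤ
x 1 0 = 1ℤ
x _ _ = 0ℤ
q 0 1 = 1ℤ
q _ _ = 0ℤ

_+_ _-_ _*_ _/_ : Series → Series → Series
(F + G) n k = F n k ℤ.+ G n k
(F - G) n k = F n k ℤ.- G n k
(F * G) n k = sumTo n λ i → sumTo k λ j → F i j ℤ.* G (n ∸ i) (k ∸ j)

_^_ : Series → ℕ → Series
F ^ zero  = one
F ^ suc m = F * F ^ m

Order≥ : ℕ → Series → Set
Order≥ a F = ∀ n k → n ℕ.+ k < a → F n k ≡ 0ℤ

Summable : (ℕ → Series) → Set
Summable F = ∀ i → Order≥ i (F i)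

-- The sum over i ≥ 0 of a summable family: the terms with i > n + k do not
-- contribute to the coefficient of xⁿqᵏ (see ∑-stable).
∑ : (ℕ → Series) → Series
∑ F n k = sumTo (n ℕ.+ k) λ i → F i n k

∑[j≥1]_ : (ℕ → Series) → Series
∑[j≥1] F = ∑ (F ∘ suc)

-- The inverse of a series with constant coefficient 1 as a geometric
-- series (see *-inverse); it has no meaning for other series.
inverse : Series → Series
inverse F = ∑ λ m → (one - F) ^ m

F / G = F * inverse G

generatingFunction : ℕ → Series
generatingFunction r n k = + C n k r

------------------------------------------------------------------------
-- Correctness of runs

private
  _≁_ : List⁺ ℕ → List⁺ ℕ → Set
  s ≁ t = List⁺.head s ≢ List⁺.head t

  Constant : List⁺ ℕ → Set
  Constant s = All (_≡ List⁺.head s) (List⁺.tail s)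

  consRun-concat : ∀ a ss → concat (map toList (consRun a ss)) ≡ a ∷ concat (map toList ss)
  consRun-concat a []              = refl
  consRun-concat a ((b ∷ bs) ∷ ss) with a ℕ.≟ b
  ... | yes _ = refl
  ... | no  _ = refl

  consRun-constant : ∀ a {ss} → All Constant ss → All Constant (consRun a ss)
  consRun-constant a []                         = [] ∷ []
  consRun-constant a {(b ∷ bs) ∷ ss} (p ∷ ps) with a ℕ.≟ b
  ... | yes refl = (refl ∷ p) ∷ ps
  ... | no  _    = [] ∷ p ∷ ps

  consRun-maximal : ∀ a {ss} → Linked _≁_ ss → Linked _≁_ (consRun a ss)
  consRun-maximal a []                       = [-]
  consRun-maximal a {(b ∷ bs) ∷ []} [-] with a ℕ.≟ b
  ... | yes refl = [-]
  ... | no  a≢b  = a≢b ∷ [-]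
  consRun-maximal a {(b ∷ bs) ∷ t ∷ ss} (p ∷ ps) with a ℕ.≟ b
  ... | yes refl = p ∷ ps
  ... | no  a≢b  = a≢b ∷ p ∷ ps

runs-concat : ∀ as → concat (map toList (runs as)) ≡ as
runs-concat []       = refl
runs-concat (a ∷ as) = trans (consRun-concat a (runs as)) (cong (a ∷_) (runs-concat as))

runs-constant : ∀ as → All (λ s → All (_≡ List⁺.head s) (List⁺.tail s)) (runs as)
runs-constant []       = []
runs-constant (a ∷ as) = consRun-constant a (runs-constant as)

runs-maximal : ∀ as → Linked (λ s t → List⁺.head s ≢ List⁺.head t) (runs as)
runs-maximal []       = []
runs-maximal (a ∷ as) = consRun-maximal a (runs-maximal as)

_ : map List⁺.length (runs (3 ∷ 5 ∷ 5 ∷ 5 ∷ 3 ∷ 3 ∷ 4 ∷ [])) ≡ 1 ∷ 3 ∷ 2 ∷ 1 ∷ []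
_ = refl

------------------------------------------------------------------------
-- Correctness of the enumeration

private
  ∈-words : ∀ n as → All (_≥ 1) as → sum as ≤ n → as ∈ words (length as) (map suc (upTo n))
  ∈-words n []           []       _   = here refl
  ∈-words n (suc a ∷ as) (_ ∷ ps) a≤n = ∈-cartesianProductWith⁺ _∷_
    (∈-map⁺ suc (∈-upTo⁺ (ℕ.m+n≤o⇒m≤o (suc a) a≤n)))
    (∈-words n as ps (ℕ.m+n≤o⇒n≤o (suc a) a≤n))

  words-unique : ∀ k {ps} → Unique ps → Unique (words k ps)
  words-unique zero    u = [] ∷ []
  words-unique (suc k) u = Unique.cartesianProductWith⁺ _∷_ ∷-injective u (words-unique k u)

∈-runRestricted⁺ : ∀ {n k r as} → IsComposition n k as → ¬ HasRun≥ r as → as ∈ runRestricted n k r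
∈-runRestricted⁺ {as = as} c@(ps , refl , refl) h = ∈-filter⁺ _ (∈-words _ as ps ℕ.≤-refl) (c , h)

∈-runRestricted⁻ : ∀ {n k r as} → as ∈ runRestricted n k r → IsComposition n k as × ¬ HasRun≥ r as
∈-runRestricted⁻ {n} {k} {r} m =
  proj₂ (∈-filter⁻ (λ as → isComposition? n k as ×-dec ¬? (hasRun≥? r as)) {xs = words k (map suc (upTo n))} m)

runRestricted-unique : ∀ n k r → Unique (runRestricted n k r)
runRestricted-unique n k r =
  Unique.filter⁺ _ (words-unique k (Unique.map⁺ ℕ.suc-injective (Unique.upTo⁺ n)))

------------------------------------------------------------------------
-- Correctness of ∑ and inverse

private
  sumTo-cong : ∀ n {f g : ℕ → ℤ} → (∀ i → i ≤ n → f i ≡ g i) → sumTo n f ≡ sumTo n g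
  sumTo-cong zero    p = p 0 z≤n
  sumTo-cong (suc n) p =
    cong₂ ℤ._+_ (sumTo-cong n λ i i≤n → p i (ℕ.m≤n⇒m≤1+n i≤n)) (p (suc n) ℕ.≤-refl)

  sumTo-zero : ∀ n {f : ℕ → ℤ} → (∀ i → i ≤ n → f i ≡ 0ℤ) → sumTo n f ≡ 0ℤ
  sumTo-zero zero    p = p 0 z≤n
  sumTo-zero (suc n) p =
    cong₂ ℤ._+_ (sumTo-zero n λ i i≤n → p i (ℕ.m≤n⇒m≤1+n i≤n)) (p (suc n) ℕ.≤-refl)

  sumTo-head : ∀ n {f : ℕ → ℤ} → (∀ i → f (suc i) ≡ 0ℤ) → sumTo n f ≡ f 0
  sumTo-head zero    p = refl
  sumTo-head (suc n) p = trans (cong₂ ℤ._+_ (sumTo-head n p) (p n)) (ℤ.+-identityʳ _)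

  interchange : ∀ a b c d → (a ℤ.+ b) ℤ.+ (c ℤ.+ d) ≡ (a ℤ.+ c) ℤ.+ (b ℤ.+ d)
  interchange = solve-∀

  sumTo-+ : ∀ n (f g : ℕ → ℤ) → sumTo n (λ i → f i ℤ.+ g i) ≡ sumTo n f ℤ.+ sumTo n g
  sumTo-+ zero    f g = refl
  sumTo-+ (suc n) f g = trans (cong (ℤ._+ (f (suc n) ℤ.+ g (suc n))) (sumTo-+ n f g))
    (interchange (sumTo n f) (sumTo n g) (f (suc n)) (g (suc n)))

  sumTo-extend : ∀ {n} d {f : ℕ → ℤ} → (∀ i → n < i → f i ≡ 0ℤ) → sumTo (d ℕ.+ n) f ≡ sumTo n f
  sumTo-extend         zero    p = refl
  sumTo-extend {n} (suc d) p =
    trans (cong₂ ℤ._+_ (sumTo-extend d p) (p _ (s≤s (ℕ.m≤n+m n d)))) (ℤ.+-identityʳ _)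

∑-stable : ∀ {F} → Summable F → ∀ n k {N} → n ℕ.+ k ≤ N → sumTo N (λ i → F i n k) ≡ ∑ F n k
∑-stable {F} s n k {N} n+k≤N =
  trans (cong (λ M → sumTo M λ i → F i n k) (sym (ℕ.m∸n+n≡m n+k≤N)))
        (sumTo-extend (N ∸ (n ℕ.+ k)) λ i lt → s i n k lt)

private
  *-cong : ∀ {F F′ G G′} n k → (∀ i j → i ≤ n → j ≤ k → F i j ≡ F′ i j) →
           (∀ i j → i ≤ n → j ≤ k → G i j ≡ G′ i j) → (F * G) n k ≡ (F′ * G′) n k
  *-cong n k p p′ = sumTo-cong n λ i i≤n → sumTo-cong k λ j j≤k →
    cong₂ ℤ._*_ (p i j i≤n j≤k) (p′ (n ∸ i) (k ∸ j) (ℕ.m∸n≤m n i) (ℕ.m∸n≤m k j))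

  *-distribˡ : ∀ F G H → F * (G + H) ≈ F * G + F * H
  *-distribˡ F G H n k = trans
    (sumTo-cong n λ i _ → trans
      (sumTo-cong k λ j _ → ℤ.*-distribˡ-+ (F i j) _ _) (sumTo-+ k _ _))
    (sumTo-+ n _ _)

  *-distribʳ : ∀ F G H → (F + G) * H ≈ F * H + G * H
  *-distribʳ F G H n k = trans
    (sumTo-cong n λ i _ → trans
      (sumTo-cong k λ j _ → ℤ.*-distribʳ-+ _ (F i j) (G i j)) (sumTo-+ k _ _))
    (sumTo-+ n _ _)

  *-identityˡ : ∀ F → one * F ≈ F
  *-identityˡ F n k = trans
    (sumTo-head n λ i → sumTo-zero k λ j _ → ℤ.*-zeroˡ (F (n ∸ suc i) (k ∸ j)))
    (trans (sumTo-head k λ j → ℤ.*-zeroˡ (F n (k ∸ suc j))) (ℤ.*-identityˡ (F n k)))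

  split : ∀ {i n j k} → i ≤ n → j ≤ k → (i ℕ.+ j) ℕ.+ ((n ∸ i) ℕ.+ (k ∸ j)) ≡ n ℕ.+ k
  split {i} {n} {j} {k} i≤n j≤k = begin
    (i ℕ.+ j) ℕ.+ ((n ∸ i) ℕ.+ (k ∸ j)) ≡⟨ ℕ-interchange i j (n ∸ i) (k ∸ j) ⟩
    (i ℕ.+ (n ∸ i)) ℕ.+ (j ℕ.+ (k ∸ j)) ≡⟨ cong₂ ℕ._+_ (ℕ.m+[n∸m]≡n i≤n) (ℕ.m+[n∸m]≡n j≤k) ⟩
    n ℕ.+ k                             ∎
    where
    open ≡-Reasoning
    open import Algebra.Properties.CommutativeSemigroup ℕ.+-commutativeSemigroup
      renaming (interchange to ℕ-interchange)

*-order : ∀ {a b F G} → Order≥ a F → Order≥ b G → Order≥ (a ℕ.+ b) (F * G)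
*-order {a} {b} {F} {G} oF oG n k lt = sumTo-zero n λ i i≤n → sumTo-zero k λ j j≤k → term i j i≤n j≤k
  where
  term : ∀ i j → i ≤ n → j ≤ k → F i j ℤ.* G (n ∸ i) (k ∸ j) ≡ 0ℤ
  term i j i≤n j≤k with i ℕ.+ j ℕ.<? a
  ... | yes i+j<a = trans (cong (ℤ._* _) (oF i j i+j<a)) (ℤ.*-zeroˡ (G (n ∸ i) (k ∸ j)))
  ... | no  i+j≮a = trans (cong (F i j ℤ.*_) (oG (n ∸ i) (k ∸ j) rest)) (ℤ.*-zeroʳ (F i j))
    where
    rest : (n ∸ i) ℕ.+ (k ∸ j) < b
    rest = ℕ.+-cancelˡ-< a _ _ (ℕ.≤-<-trans
      (ℕ.≤-trans (ℕ.+-monoˡ-≤ _ (ℕ.≮⇒≥ i+j≮a)) (ℕ.≤-reflexive (split i≤n j≤k))) lt)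

^-order : ∀ {F} → Order≥ 1 F → ∀ m → Order≥ m (F ^ m)
^-order oF zero    n k ()
^-order oF (suc m) = *-order oF (^-order oF m)

private
  one-order : ∀ {F} → F 0 0 ≡ 1ℤ → Order≥ 1 (one - F)
  one-order F₀ zero zero _ = cong (λ z → 1ℤ ℤ.- z) F₀
  one-order F₀ zero    (suc k) (s≤s ())
  one-order F₀ (suc n) k       (s≤s ())

  partial : (ℕ → Series) → ℕ → Series
  partial F N n k = sumTo N λ i → F i n k

  *-partial : ∀ G F N → G * partial F N ≈ partial (λ i → G * F i) N
  *-partial G F zero    n k = refl
  *-partial G F (suc N) n k =
    trans (*-distribˡ G (partial F N) (F (suc N)) n k) 
    (cong (ℤ._+ (G * F (suc N)) n k) (*-partial G F N n k))

  telescope : ∀ N (f : ℕ → ℤ) → f 0 ℤ.+ sumTo N (f ∘ suc) ≡ sumTo N f ℤ.+ f (suc N)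
  telescope zero    f = refl
  telescope (suc N) f =
    trans (sym (ℤ.+-assoc (f 0) _ _)) (cong (ℤ._+ f (suc (suc N))) (telescope N f))

  cancel : ∀ a b c d → a ℤ.+ b ≡ c → d ℤ.+ b ≡ c ℤ.+ 0ℤ → a ≡ d
  cancel a b c d p p′ = ∙-cancelʳ b a d (trans p (sym (trans p′ (ℤ.+-identityʳ c))))
    where open import Algebra.Properties.AbelianGroup ℤ.+-0-abelianGroup using (∙-cancelʳ)

*-inverse : ∀ {F} → F 0 0 ≡ 1ℤ → F * inverse F ≈ one
*-inverse {F} F₀ n k = cancel _ _ _ _ step₁ step₂
  where
  open ≡-Reasoning
  N = n ℕ.+ k
  G = one - F
  P = partial (G ^_) N

  G^-summable : Summable (G ^_)
  G^-summable = ^-order (one-order F₀)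

  F+G : ∀ a b → a ℤ.+ (b ℤ.- a) ≡ b
  F+G = solve-∀

  step₁ : (F * inverse F) n k ℤ.+ sumTo N (λ m → (G ^ suc m) n k) ≡ P n k
  step₁ = begin
    (F * inverse F) n k ℤ.+ sumTo N (λ m → (G ^ suc m) n k)
      ≡⟨ cong₂ ℤ._+_
           (*-cong {F} {F} {inverse F} {P} n k (λ _ _ _ _ → refl) λ i j i≤n j≤k →
             sym (∑-stable G^-summable i j (ℕ.+-mono-≤ i≤n j≤k)))
           (sym (*-partial G (G ^_) N n k)) ⟩
    (F * P) n k ℤ.+ (G * P) n k
      ≡⟨ *-distribʳ F G P n k ⟨
    ((F + G) * P) n k
      ≡⟨ *-cong {F + G} {one} {P} {P} n k (λ i j _ _ → F+G (F i j) (one i j)) (λ _ _ _ _ → refl) ⟩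
    (one * P) n k
      ≡⟨ *-identityˡ P n k ⟩
    P n k ∎

  step₂ : one n k ℤ.+ sumTo N (λ m → (G ^ suc m) n k) ≡ P n k ℤ.+ 0ℤ
  step₂ = trans (telescope N λ m → (G ^ m) n k)
                (cong (λ z → P n k ℤ.+ z) (G^-summable (suc N) n k ℕ.≤-refl))

------------------------------------------------------------------------
-- The quotients and the infinite sum in denominator are meaningful

private
  x-order : Order≥ 1 x
  x-order zero    zero    _ = refl
  x-order zero    (suc k) (s≤s ())
  x-order (suc n) k       (s≤s ())

  q-order : Order≥ 1 q
  q-order zero    zero    _ = refl
  q-order zero    (suc k) (s≤s ())
  q-order (suc n) k       (s≤s ())

  order-mono : ∀ {a b F} → a ≤ b → Order≥ b F → Order≥ a F
  order-mono a≤b o n k lt = o n k (ℕ.<-≤-trans lt a≤b)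

  order-zero : ∀ {F} → Order≥ 0 F
  order-zero n k ()

runTerm : ℕ → ℕ → Series
runTerm r j = (x ^ (r ℕ.* j) * (one - q * x ^ j)) / (one - q ^ r * x ^ (r ℕ.* j))

denominator : ℕ → Series
denominator r = one - (x * q) / (one - x) + q ^ r * (∑[j≥1] (runTerm r))

1-x-unit : (one - x) 0 0 ≡ 1ℤ
1-x-unit = refl

runTerm-unit : ∀ {r} → r ≥ 1 → ∀ j → (one - q ^ r * x ^ (r ℕ.* j)) 0 0 ≡ 1ℤ
runTerm-unit {r} r≥1 j = cong (λ z → 1ℤ ℤ.- z)
  (order-mono (ℕ.≤-trans r≥1 (ℕ.m≤m+n r _)) (*-order (^-order q-order r) (^-order x-order (r ℕ.* j))) 0 0 (s≤s z≤n))

runTerm-summable : ∀ {r} → r ≥ 1 → Summable (runTerm r ∘ suc)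
runTerm-summable {suc r} _ i = order-mono i≤
  (*-order (*-order (^-order x-order (suc r ℕ.* suc i)) (order-zero {one - q * x ^ suc i}))
    (order-zero {inverse (one - q ^ suc r * x ^ (suc r ℕ.* suc i))}))
  where
  i≤ : i ≤ suc r ℕ.* suc i ℕ.+ 0 ℕ.+ 0
  i≤ = ℕ.≤-trans (ℕ.n≤1+n i) (ℕ.≤-trans (ℕ.m≤m+n (suc i) (r ℕ.* suc i))
         (ℕ.≤-trans (ℕ.m≤m+n _ 0) (ℕ.m≤m+n _ 0)))

denominator-unit : ∀ {r} → r ≥ 1 → denominator r 0 0 ≡ 1ℤ
denominator-unit {r} r≥1 = cong (λ z → 1ℤ ℤ.+ z)
  (order-mono (ℕ.≤-trans r≥1 (ℕ.m≤m+n r 0)) (*-order (^-order q-order r) (order-zero {∑[j≥1] (runTerm r)})) 0 0 (s≤s z≤n))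

{-# OPTIONS --safe #-}

-- For a part a ≥ 1 put u = q xᵃ, and split the series G of restricted
-- compositions as G = A + H, where A counts those starting with a.  Prepending
-- a to a restricted composition gives either a restricted composition starting
-- with a, or a run of exactly r copies of a followed by a restricted
-- composition not starting with a:
--     u G = A + uʳ H.
-- Hence (1 - u) G = (1 - uʳ) H, so that uʳ (1 - u) / (1 - uʳ) · G = uʳ H, and
-- the denominator times G is G - ∑ₐ u G + ∑ₐ uʳ H = G - ∑ₐ A, which is 1 because
-- every nonempty composition has a unique first part.

module Submission where

open import Algebra.Bundles using (CommutativeRing; RawRing)
import Algebra.Construct.Pointwise as Pointwise
import Algebra.Morphism.RingMonomorphism as RingMonomorphism
open import Algebra.Morphism.Structures using (IsRingMonomorphism)
open import Data.Empty using (⊥-elim)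
open import Data.Integer as ℤ using (ℤ; +_; 0ℤ; 1ℤ)
import Data.Integer.Properties as ℤ
open import Data.Integer.Tactic.RingSolver using (solve-∀)
open import Data.List using (List; []; _∷_; _++_; filter; head; length; map; replicate)
open import Data.List.Membership.Propositional using (_∈_)
open import Data.List.Membership.Propositional.Properties using (∈-++⁺ˡ; ∈-++⁺ʳ; ∈-++⁻; ∈-filter⁺; ∈-filter⁻; ∈-map⁺; ∈-map⁻)
open import Data.List.Membership.Propositional.Properties.WithK using (unique∧set⇒bag)
open import Data.List.NonEmpty using (_∷_)
open import Data.List.Properties using (length-++; length-map; length-replicate; ∷-injectiveʳ)
open import Data.List.Relation.Binary.BagAndSetEquality using (∼bag⇒↭)
open import Data.List.Relation.Binary.Permutation.Propositional.Properties using (↭-length)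
open import Data.List.Relation.Unary.All using ([]; _∷_)
open import Data.List.Relation.Unary.Any using (here; there)
open import Data.List.Relation.Unary.Unique.Propositional using (Unique; []; _∷_)
import Data.List.Relation.Unary.Unique.Propositional.Properties as Unique
open import Data.Maybe using (just)
open import Data.Maybe.Properties using (just-injective; ≡-dec)
open import Data.Nat as ℕ using (ℕ; zero; suc; _∸_; _≤_; _<_; _≥_; z≤n; s≤s)
import Data.Nat.Properties as ℕ
open import Data.Product using (∃; ∃₂; _×_; _,_; proj₁; proj₂)
open import Data.Sum using (_⊎_; inj₁; inj₂; [_,_]′)
open import Function using (_∘_; id; mk⇔)
open import Level using (0ℓ)
open import Relation.Binary.PropositionalEquality as ≡ using (_≡_; _≢_)
import Relation.Binary.Reasoning.Setoid as ≈-Reasoning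
open import Relation.Nullary using (¬_; yes; no; ¬?)
open import Relation.Unary using (Decidable)

-- Power series in one variable over a commutative ring.

module PowerSeries {c ℓ} (R : CommutativeRing c ℓ) where
  open CommutativeRing R
  open ≈-Reasoning setoid
  open import Algebra.Properties.CommutativeSemigroup
    (CommutativeRing.+-commutativeSemigroup R) using (interchange)

  Seq : Set c
  Seq = ℕ → Carrier

  infix  4 _≋_
  infixl 6 _⊞_
  infixl 7 _⊛_

  _≋_ : Seq → Seq → Set ℓ
  f ≋ g = ∀ n → f n ≈ g n

  _⊞_ : Seq → Seq → Seq
  (f ⊞ g) n = f n + g n

  -- The Cauchy product, by recursion that peels off the lowest coefficient of the left factor. This
  -- avoids truncated subtraction in indices, and the ring laws follow by induction on `n` with
  -- `f ∘ suc` in place of `f`.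
  _⊛_ : Seq → Seq → Seq
  (f ⊛ g) zero    = f 0 * g 0
  (f ⊛ g) (suc n) = f 0 * g (suc n) + (f ∘ suc ⊛ g) n

  0s : Seq
  0s _ = 0#

  constant : Carrier → Seq
  constant c zero    = c
  constant c (suc _) = 0#

  indeterminate : Seq
  indeterminate zero    = 0#
  indeterminate (suc n) = constant 1# n

  ⊛-cong : ∀ {f f′ g g′} → f ≋ f′ → g ≋ g′ → f ⊛ g ≋ f′ ⊛ g′
  ⊛-cong p p′ zero    = *-cong (p 0) (p′ 0)
  ⊛-cong p p′ (suc n) = +-cong (*-cong (p 0) (p′ (suc n))) (⊛-cong (p ∘ suc) p′ n)

  ⊛-zeroˡ : ∀ f → 0s ⊛ f ≋ 0s
  ⊛-zeroˡ f zero    = zeroˡ (f 0)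
  ⊛-zeroˡ f (suc n) = trans (+-cong (zeroˡ _) (⊛-zeroˡ f n)) (+-identityˡ 0#)

  constant-⊛ : ∀ c f n → (constant c ⊛ f) n ≈ c * f n
  constant-⊛ c f zero    = refl
  constant-⊛ c f (suc n) = trans (+-congˡ (⊛-zeroˡ f n)) (+-identityʳ _)

  ⊛-identityˡ : ∀ f → constant 1# ⊛ f ≋ f
  ⊛-identityˡ f n = trans (constant-⊛ 1# f n) (*-identityˡ (f n))

  indeterminate-⊛-suc : ∀ f n → (indeterminate ⊛ f) (suc n) ≈ f n
  indeterminate-⊛-suc f n = begin
    0# * f (suc n) + (constant 1# ⊛ f) n ≈⟨ +-cong (zeroˡ _) (⊛-identityˡ f n) ⟩
    0# + f n                             ≈⟨ +-identityˡ (f n) ⟩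
    f n                                  ∎

  ⊛-distribʳ : ∀ h f g → (f ⊞ g) ⊛ h ≋ f ⊛ h ⊞ g ⊛ h
  ⊛-distribʳ h f g zero    = distribʳ (h 0) (f 0) (g 0)
  ⊛-distribʳ h f g (suc n) = begin
    (f 0 + g 0) * h (suc n) + ((f ∘ suc ⊞ g ∘ suc) ⊛ h) n
      ≈⟨ +-cong (distribʳ _ _ _) (⊛-distribʳ h (f ∘ suc) (g ∘ suc) n) ⟩
    (f 0 * h (suc n) + g 0 * h (suc n)) + ((f ∘ suc ⊛ h) n + (g ∘ suc ⊛ h) n)
      ≈⟨ interchange _ _ _ _ ⟩
    (f ⊛ h ⊞ g ⊛ h) (suc n) ∎

  scale-⊛ : ∀ c f g n → ((λ i → c * f i) ⊛ g) n ≈ c * (f ⊛ g) n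
  scale-⊛ c f g zero    = *-assoc c (f 0) (g 0)
  scale-⊛ c f g (suc n) = begin
    c * f 0 * g (suc n) + ((λ i → c * f (suc i)) ⊛ g) n
      ≈⟨ +-cong (*-assoc c _ _) (scale-⊛ c (f ∘ suc) g n) ⟩
    c * (f 0 * g (suc n)) + c * (f ∘ suc ⊛ g) n
      ≈⟨ distribˡ c _ _ ⟨
    c * (f ⊛ g) (suc n) ∎

  ⊛-assoc : ∀ f g h → (f ⊛ g) ⊛ h ≋ f ⊛ (g ⊛ h)
  ⊛-assoc f g h zero    = *-assoc (f 0) (g 0) (h 0)
  ⊛-assoc f g h (suc n) = begin
    -- By definition the shift of `f ⊛ g` is the scaled shift of `g` plus `f ∘ suc ⊛ g`; the
    -- induction hypothesis applies to the second summand.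
    f 0 * g 0 * h (suc n) + (((λ i → f 0 * g (suc i)) ⊞ f ∘ suc ⊛ g) ⊛ h) n
      ≈⟨ +-cong (*-assoc _ _ _) (⊛-distribʳ h (λ i → f 0 * g (suc i)) (f ∘ suc ⊛ g) n) ⟩
    f 0 * (g 0 * h (suc n)) + (((λ i → f 0 * g (suc i)) ⊛ h) n + ((f ∘ suc ⊛ g) ⊛ h) n)
      ≈⟨ +-congˡ (+-cong (scale-⊛ (f 0) (g ∘ suc) h n) (⊛-assoc (f ∘ suc) g h n)) ⟩
    f 0 * (g 0 * h (suc n)) + (f 0 * (g ∘ suc ⊛ h) n + (f ∘ suc ⊛ (g ⊛ h)) n)
      ≈⟨ +-assoc _ _ _ ⟨
    f 0 * (g 0 * h (suc n)) + f 0 * (g ∘ suc ⊛ h) n + (f ∘ suc ⊛ (g ⊛ h)) n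
      ≈⟨ +-congʳ (distribˡ (f 0) _ _) ⟨
    (f ⊛ (g ⊛ h)) (suc n) ∎

  -- Peels the right factor instead of the left one, which is what `⊛-comm` needs, since swapping
  -- the factors swaps the side on which the recursion acts.
  ⊛-last : ∀ f g n → (f ⊛ g) (suc n) ≈ (f ⊛ g ∘ suc) n + f (suc n) * g 0
  ⊛-last f g zero    = refl
  ⊛-last f g (suc n) = trans (+-congˡ (⊛-last (f ∘ suc) g n)) (sym (+-assoc _ _ _))

  ⊛-comm : ∀ f g → f ⊛ g ≋ g ⊛ f
  ⊛-comm f g zero    = *-comm (f 0) (g 0)
  ⊛-comm f g (suc n) = begin
    f 0 * g (suc n) + (f ∘ suc ⊛ g) n ≈⟨ +-cong (*-comm _ _) (⊛-comm (f ∘ suc) g n) ⟩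
    g (suc n) * f 0 + (g ⊛ f ∘ suc) n ≈⟨ +-comm _ _ ⟩
    (g ⊛ f ∘ suc) n + g (suc n) * f 0 ≈⟨ ⊛-last g f n ⟨
    (g ⊛ f) (suc n)                   ∎

  commutativeRing : CommutativeRing c ℓ
  commutativeRing = record
    { _≈_ = _≋_
    ; _+_ = _⊞_
    ; _*_ = _⊛_
    ; -_  = λ f n → - f n
    ; 0#  = 0s
    ; 1#  = constant 1#
    ; isCommutativeRing = record
      { isRing = record
        { +-isAbelianGroup = Pointwise.isAbelianGroup ℕ +-isAbelianGroup
        ; *-cong           = ⊛-cong
        ; *-assoc          = ⊛-assoc
        ; *-identity       = ⊛-identityˡ , λ f n → trans (⊛-comm f _ n) (⊛-identityˡ f n)
        ; distrib          = (λ f g h n → trans (⊛-comm f _ n) (trans (⊛-distribʳ f g h n)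
                                            (+-cong (⊛-comm g f n) (⊛-comm h f n))))
                           , ⊛-distribʳ
        }
      ; *-comm = ⊛-comm
      }
    }

open import Defs

-- The ring of series in `x` and `q`, as series in `x` over series in `q`.

module ℤ⟦q⟧ = PowerSeries ℤ.+-*-commutativeRing
module ℤ⟦q⟧⟦x⟧ = PowerSeries ℤ⟦q⟧.commutativeRing

sumTo-cong : ∀ n {f g : ℕ → ℤ} → (∀ i → i ≤ n → f i ≡ g i) → sumTo n f ≡ sumTo n g
sumTo-cong zero    p = p 0 z≤n
sumTo-cong (suc n) p =
  ≡.cong₂ ℤ._+_ (sumTo-cong n λ i i≤n → p i (ℕ.m≤n⇒m≤1+n i≤n)) (p (suc n) ℕ.≤-refl)

-- `sumTo` grows at its upper end while `⊛` unfolds at its lower end; this bridges the two.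
sumTo-suc : ∀ n (f : ℕ → ℤ) → sumTo (suc n) f ≡ f 0 ℤ.+ sumTo n (f ∘ suc)
sumTo-suc zero    f = ≡.refl
sumTo-suc (suc n) f =
  ≡.trans (≡.cong (ℤ._+ f (suc (suc n))) (sumTo-suc n f)) (ℤ.+-assoc (f 0) _ _)

sumTo-⊛ : ∀ k f g → sumTo k (λ j → f j ℤ.* g (k ∸ j)) ≡ (f ℤ⟦q⟧.⊛ g) k
sumTo-⊛ zero    f g = ≡.refl
sumTo-⊛ (suc k) f g = ≡.trans (sumTo-suc k _) (≡.cong (λ z → f 0 ℤ.* g (suc k) ℤ.+ z) (sumTo-⊛ k (f ∘ suc) g))

*-⊛ : ∀ F G → F * G ≈ F ℤ⟦q⟧⟦x⟧.⊛ G
*-⊛ F G zero    k = sumTo-⊛ k (F 0) (G 0)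
*-⊛ F G (suc n) k = ≡.trans (sumTo-suc n _)
  (≡.cong₂ ℤ._+_ (sumTo-⊛ k (F 0) (G (suc n))) (*-⊛ (F ∘ suc) G n k))

one-constant : one ≈ ℤ⟦q⟧⟦x⟧.constant (ℤ⟦q⟧.constant 1ℤ)
one-constant zero    zero    = ≡.refl
one-constant zero    (suc k) = ≡.refl
one-constant (suc n) k       = ≡.refl

q-constant : q ≈ ℤ⟦q⟧⟦x⟧.constant ℤ⟦q⟧.indeterminate
q-constant zero    zero          = ≡.refl
q-constant zero    (suc zero)    = ≡.refl
q-constant zero    (suc (suc k)) = ≡.refl
q-constant (suc n) k             = ≡.refl

x-indeterminate : x ≈ ℤ⟦q⟧⟦x⟧.indeterminate
x-indeterminate zero          k       = ≡.refl
x-indeterminate (suc zero)    zero    = ≡.refl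
x-indeterminate (suc zero)    (suc k) = ≡.refl
x-indeterminate (suc (suc n)) k       = ≡.refl

seriesRawRing : RawRing 0ℓ 0ℓ
seriesRawRing = record
  { _≈_ = _≈_ ; _+_ = _+_ ; _*_ = _*_ ; -_ = λ F n k → ℤ.- F n k ; 0# = λ _ _ → 0ℤ ; 1# = one }

-- Both rings have the same carrier and the same equality, so the identity map is injective, and the
-- ring laws for the double convolution `_*_` can be pulled back from the iterated construction.
series-isRingMonomorphism : IsRingMonomorphism seriesRawRing (CommutativeRing.rawRing ℤ⟦q⟧⟦x⟧.commutativeRing) id
series-isRingMonomorphism = record
  { isRingHomomorphism = record
    { isSemiringHomomorphism = record
      { isNearSemiringHomomorphism = record
        { +-isMonoidHomomorphism = record
          { isMagmaHomomorphism = record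
            { isRelHomomorphism = record { cong = id }
            ; homo              = λ _ _ _ _ → ≡.refl
            }
          ; ε-homo = λ _ _ → ≡.refl
          }
        ; *-homo = *-⊛
        }
      ; 1#-homo = one-constant
      }
    ; -‿homo = λ _ _ _ → ≡.refl
    }
  ; injective = id
  }

seriesRing : CommutativeRing 0ℓ 0ℓ
seriesRing = record
  { RawRing seriesRawRing
  ; isCommutativeRing = RingMonomorphism.isCommutativeRing series-isRingMonomorphism
      (CommutativeRing.isCommutativeRing ℤ⟦q⟧⟦x⟧.commutativeRing)
  }

module 𝕊 = CommutativeRing seriesRing

-- Powers, and multiplication by `q` and `x` as shifts of coefficients.

q*-⊛ : ∀ F → q * F ≈ ℤ⟦q⟧⟦x⟧.constant ℤ⟦q⟧.indeterminate ℤ⟦q⟧⟦x⟧.⊛ F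
q*-⊛ F n k = ≡.trans (*-⊛ q F n k) (ℤ⟦q⟧⟦x⟧.⊛-cong {g = F} q-constant (λ _ _ → ≡.refl) n k)

x*-⊛ : ∀ F → x * F ≈ ℤ⟦q⟧⟦x⟧.indeterminate ℤ⟦q⟧⟦x⟧.⊛ F
x*-⊛ F n k = ≡.trans (*-⊛ x F n k) (ℤ⟦q⟧⟦x⟧.⊛-cong {g = F} x-indeterminate (λ _ _ → ≡.refl) n k)

q*-zero : ∀ F n → (q * F) n 0 ≡ 0ℤ
q*-zero F n = ≡.trans (q*-⊛ F n 0) (ℤ⟦q⟧⟦x⟧.constant-⊛ ℤ⟦q⟧.indeterminate F n 0)

q*-suc : ∀ F n k → (q * F) n (suc k) ≡ F n k
q*-suc F n k = ≡.trans (q*-⊛ F n (suc k))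
  (≡.trans (ℤ⟦q⟧⟦x⟧.constant-⊛ ℤ⟦q⟧.indeterminate F n (suc k)) (ℤ⟦q⟧.indeterminate-⊛-suc (F n) k))

x*-zero : ∀ F k → (x * F) 0 k ≡ 0ℤ
x*-zero F k = ≡.trans (x*-⊛ F 0 k) (ℤ⟦q⟧.⊛-zeroˡ (F 0) k)

x*-suc : ∀ F n k → (x * F) (suc n) k ≡ F n k
x*-suc F n k = ≡.trans (x*-⊛ F (suc n) k) (ℤ⟦q⟧⟦x⟧.indeterminate-⊛-suc F n k)

open import Algebra.Properties.Ring 𝕊.ring using ([y-z]x≈yx-zx)
open import Algebra.Solver.CommutativeMonoid 𝕊.*-commutativeMonoid using (solve; _⊕_; _⊜_)
open ≈-Reasoning 𝕊.setoid

^-cong : ∀ {F G} → F ≈ G → ∀ m → F ^ m ≈ G ^ m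
^-cong         p zero    = 𝕊.refl {one}
^-cong {F} {G} p (suc m) = 𝕊.*-cong {F} {G} {F ^ m} {G ^ m} p (^-cong p m)

^-+ : ∀ F m n → F ^ (m ℕ.+ n) ≈ F ^ m * F ^ n
^-+ F zero    n = 𝕊.sym {one * F ^ n} {F ^ n} (𝕊.*-identityˡ (F ^ n))
^-+ F (suc m) n = begin
  F * F ^ (m ℕ.+ n)   ≈⟨ 𝕊.*-congˡ {F} (^-+ F m n) ⟩
  F * (F ^ m * F ^ n) ≈⟨ 𝕊.*-assoc F (F ^ m) (F ^ n) ⟨
  F ^ suc m * F ^ n   ∎

x^*-+ : ∀ a F m k → (x ^ a * F) (a ℕ.+ m) k ≡ F m k
x^*-+ zero    F m k = 𝕊.*-identityˡ F m k
x^*-+ (suc a) F m k = ≡.trans (𝕊.*-assoc x (x ^ a) F (suc a ℕ.+ m) k)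
  (≡.trans (x*-suc (x ^ a * F) (a ℕ.+ m) k) (x^*-+ a F m k))

x^*-< : ∀ a F {n} k → n < a → (x ^ a * F) n k ≡ 0ℤ
x^*-< (suc a) F {zero}  k _         = ≡.trans (𝕊.*-assoc x (x ^ a) F 0 k) (x*-zero (x ^ a * F) k)
x^*-< (suc a) F {suc n} k (s≤s n<a) = ≡.trans (𝕊.*-assoc x (x ^ a) F (suc n) k)
  (≡.trans (x*-suc (x ^ a * F) n k) (x^*-< a F k n<a))

-- Infinite sums and the geometric series.

∑-cong : ∀ {F G : ℕ → Series} → (∀ i → F i ≈ G i) → ∑ F ≈ ∑ G
∑-cong p n k = sumTo-cong (n ℕ.+ k) λ i _ → p i n k

sumTo-+ : ∀ n (f g : ℕ → ℤ) → sumTo n (λ i → f i ℤ.+ g i) ≡ sumTo n f ℤ.+ sumTo n g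
sumTo-+ zero    f g = ≡.refl
sumTo-+ (suc n) f g = ≡.trans (≡.cong (ℤ._+ (f (suc n) ℤ.+ g (suc n))) (sumTo-+ n f g))
  (ℤ-interchange (sumTo n f) (sumTo n g) (f (suc n)) (g (suc n)))
  where
  open import Algebra.Properties.CommutativeSemigroup ℤ.+-commutativeSemigroup
    renaming (interchange to ℤ-interchange)

∑-+ : ∀ F G → ∑ (λ i → F i + G i) ≈ ∑ F + ∑ G
∑-+ F G n k = sumTo-+ (n ℕ.+ k) (λ i → F i n k) (λ i → G i n k)

partialSum : (ℕ → Series) → ℕ → Series
partialSum F N n k = sumTo N λ i → F i n k

*-partialSum : ∀ G F N → G * partialSum F N ≈ partialSum (λ i → G * F i) N
*-partialSum G F zero    = 𝕊.refl {G * F 0}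
*-partialSum G F (suc N) n k = ≡.trans (𝕊.distribˡ G (partialSum F N) (F (suc N)) n k)
  (≡.cong (ℤ._+ (G * F (suc N)) n k) (*-partialSum G F N n k))

-- The coefficient at `n`, `k` of the product uses only coefficients of `∑ F` at smaller or equal
-- indices. By `∑-stable` all of these may be computed with the common cutoff `n + k`, so finite
-- distributivity suffices.
*-∑ : ∀ G {F} → Summable F → G * ∑ F ≈ ∑ (λ i → G * F i)
*-∑ G {F} s n k = ≡.trans
  (sumTo-cong n λ i i≤n → sumTo-cong k λ j j≤k → ≡.cong (G i j ℤ.*_)
    (≡.sym (∑-stable s (n ∸ i) (k ∸ j) (ℕ.+-mono-≤ (ℕ.m∸n≤m n i) (ℕ.m∸n≤m k j)))))
  (*-partialSum G F (n ℕ.+ k) n k)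

x-order : Order≥ 1 x
x-order zero    zero    _        = ≡.refl
x-order zero    (suc k) (s≤s ())
x-order (suc n) k       (s≤s ())

inverse-one-x : inverse (one - x) ≈ ∑ (x ^_)
inverse-one-x = ∑-cong (^-cong λ n k → cancel (one n k) (x n k))
  where
  cancel : ∀ a b → a ℤ.- (a ℤ.- b) ≡ b
  cancel = solve-∀

one-sub-* : ∀ F G → (one - F) * G ≈ G - F * G
one-sub-* F G n k = ≡.trans ([y-z]x≈yx-zx G one F n k)
  (≡.cong (ℤ._- (F * G) n k) (𝕊.*-identityˡ G n k))

geometric-* : ∀ G → (x * q) / (one - x) * G ≈ ∑[j≥1] (λ j → q * x ^ j * G)
geometric-* G = begin
  x * q * inverse (one - x) * G
    ≈⟨ 𝕊.*-congʳ {G} (𝕊.*-congˡ {x * q} inverse-one-x) ⟩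
  x * q * ∑ (x ^_) * G
    ≈⟨ solve 3 (λ A S G → (A ⊕ S) ⊕ G ⊜ (A ⊕ G) ⊕ S) (λ _ _ → ≡.refl) (x * q) (∑ (x ^_)) G ⟩
  x * q * G * ∑ (x ^_)
    ≈⟨ *-∑ (x * q * G) (^-order x-order) ⟩
  ∑ (λ m → x * q * G * x ^ m)
    -- The factor `x` of the numerator joins `x ^ m` to give `x ^ suc m`, so the sum now starts at
    -- exponent 1.
    ≈⟨ ∑-cong (λ m → solve 4 (λ X Q G Y → ((X ⊕ Q) ⊕ G) ⊕ Y ⊜ (Q ⊕ (X ⊕ Y)) ⊕ G) (λ _ _ → ≡.refl) x q G (x ^ m)) ⟩
  ∑[j≥1] (λ j → q * x ^ j * G) ∎

-- From the three relations for `G`, `A`, `H` to the quotient; index `j` belongs to the part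
-- `suc j`.

module _ {r} (r≥1 : r ≥ 1) {G : Series} {A H : ℕ → Series}
  (split : ∀ j → G ≈ A j + H j)
  (prepend : ∀ j → q * x ^ suc j * G ≈ A j + q ^ r * x ^ (r ℕ.* suc j) * H j)
  (total : G ≈ one + ∑ A)
  where

  -- Subtracting `prepend` from `split` cancels `A j`.
  one-sub-swap : ∀ j → (one - q * x ^ suc j) * G ≈ (one - q ^ r * x ^ (r ℕ.* suc j)) * H j
  one-sub-swap j = begin
    (one - u) * G             ≈⟨ one-sub-* u G ⟩
    G - u * G                 ≈⟨ (λ n k → ≡.cong₂ ℤ._-_ (split j n k) (prepend j n k)) ⟩
    A j + H j - (A j + v * H j) ≈⟨ (λ n k → cancel (A j n k) (H j n k) ((v * H j) n k)) ⟩
    H j - v * H j             ≈⟨ one-sub-* v (H j) ⟨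
    (one - v) * H j           ∎
    where
    u = q * x ^ suc j
    v = q ^ r * x ^ (r ℕ.* suc j)
    cancel : ∀ a h z → (a ℤ.+ h) ℤ.- (a ℤ.+ z) ≡ h ℤ.- z
    cancel = solve-∀

  -- The numerator factor `B` acting on `G` equals `V` acting on `H j`, and this `V` cancels the
  -- inverse `I` of the run term.
  runTerm-* : ∀ j → q ^ r * G * runTerm r (suc j) ≈ q ^ r * x ^ (r ℕ.* suc j) * H j
  runTerm-* j = begin
    Q * G * ((X * B) * I)
      ≈⟨ solve 5 (λ Q G X B I → (Q ⊕ G) ⊕ ((X ⊕ B) ⊕ I) ⊜ ((Q ⊕ X) ⊕ I) ⊕ (B ⊕ G)) (λ _ _ → ≡.refl) Q G X B I ⟩
    Q * X * I * (B * G)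
      ≈⟨ 𝕊.*-congˡ {Q * X * I} (one-sub-swap j) ⟩
    Q * X * I * (V * H j)
      ≈⟨ solve 4 (λ W I V H → (W ⊕ I) ⊕ (V ⊕ H) ⊜ (V ⊕ I) ⊕ (W ⊕ H)) (λ _ _ → ≡.refl) (Q * X) I V (H j) ⟩
    V * I * (Q * X * H j)
      ≈⟨ 𝕊.*-congʳ {Q * X * H j} (*-inverse {V} (runTerm-unit r≥1 (suc j))) ⟩
    one * (Q * X * H j)
      ≈⟨ 𝕊.*-identityˡ (Q * X * H j) ⟩
    Q * X * H j ∎
    where
    Q = q ^ r
    X = x ^ (r ℕ.* suc j)
    B = one - q * x ^ suc j
    V = one - Q * X
    I = inverse V

  denominator-* : denominator r * G ≈ one
  denominator-* = begin
    (one - U + Q * S) * G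
      ≈⟨ 𝕊.distribʳ G (one - U) (Q * S) ⟩
    (one - U) * G + Q * S * G
      ≈⟨ 𝕊.+-cong {(one - U) * G} {G - U * G} {Q * S * G} {Q * G * S} (one-sub-* U G)
           (solve 3 (λ Q S G → (Q ⊕ S) ⊕ G ⊜ (Q ⊕ G) ⊕ S) (λ _ _ → ≡.refl) Q S G) ⟩
    G - U * G + Q * G * S
      -- `∑ A` from `total` cancels against the one in `UG`, and the `∑ W` of `UG` against that of
      -- `QGS`; only `one` survives.
      ≈⟨ (λ n k → ≡.cong₂ ℤ._+_ (≡.cong₂ ℤ._-_ (total n k) (UG n k)) (QGS n k)) ⟩
    one + ∑ A - (∑ A + ∑ W) + ∑ W
      ≈⟨ (λ n k → cancel (one n k) (∑ A n k) (∑ W n k)) ⟩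
    one ∎
    where
    U = (x * q) / (one - x)
    Q = q ^ r
    S = ∑[j≥1] (runTerm r)
    W = λ j → q ^ r * x ^ (r ℕ.* suc j) * H j

    UG : U * G ≈ ∑ A + ∑ W
    UG = begin
      U * G                        ≈⟨ geometric-* G ⟩
      ∑[j≥1] (λ j → q * x ^ j * G) ≈⟨ ∑-cong prepend ⟩
      ∑ (λ j → A j + W j)          ≈⟨ ∑-+ A W ⟩
      ∑ A + ∑ W                    ∎

    QGS : Q * G * S ≈ ∑ W
    QGS = begin
      Q * G * S                              ≈⟨ *-∑ (Q * G) (runTerm-summable r≥1) ⟩
      ∑ (λ j → Q * G * runTerm r (suc j))    ≈⟨ ∑-cong runTerm-* ⟩
      ∑ W                                    ∎

    cancel : ∀ o a w → (o ℤ.+ a) ℤ.- (a ℤ.+ w) ℤ.+ w ≡ o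
    cancel = solve-∀

  quotient : G ≈ one / denominator r
  quotient = begin
    G                 ≈⟨ 𝕊.*-identityʳ G ⟨
    G * one           ≈⟨ 𝕊.*-congˡ {G} (*-inverse {D} (denominator-unit r≥1)) ⟨
    G * (D * I)       ≈⟨ solve 3 (λ G D I → G ⊕ (D ⊕ I) ⊜ (D ⊕ G) ⊕ I) (λ _ _ → ≡.refl) G D I ⟩
    D * G * I         ≈⟨ 𝕊.*-congʳ {I} denominator-* ⟩
    one * I           ∎
    where
    D = denominator r
    I = inverse D

-- The leading run of a list.

StartsWith : ℕ → List ℕ → Set
StartsWith a as = head as ≡ just a

startsWith? : ∀ a → Decidable (StartsWith a)
startsWith? a as = ≡-dec ℕ._≟_ (head as) (just a)

-- `consRun` compares a new part with the head of the first block only; this identifies that head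
-- with the first part of the list.
runs-∷ : ∀ a as → ∃₂ λ bs ss → runs (a ∷ as) ≡ (a ∷ bs) ∷ ss
runs-∷ a as with runs as
... | []            = [] , [] , ≡.refl
... | (b ∷ bs) ∷ ss with a ℕ.≟ b
...   | yes _ = b ∷ bs , ss , ≡.refl
...   | no  _ = [] , (b ∷ bs) ∷ ss , ≡.refl

consRun-≡ : ∀ a bs ss → consRun a ((a ∷ bs) ∷ ss) ≡ (a ∷ a ∷ bs) ∷ ss
consRun-≡ a bs ss with a ℕ.≟ a
... | yes _   = ≡.refl
... | no  a≢a = ⊥-elim (a≢a ≡.refl)

consRun-≢ : ∀ {a b} bs ss → a ≢ b → consRun a ((b ∷ bs) ∷ ss) ≡ (a ∷ []) ∷ (b ∷ bs) ∷ ss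
consRun-≢ {a} {b} bs ss a≢b with a ℕ.≟ b
... | yes a≡b = ⊥-elim (a≢b a≡b)
... | no  _   = ≡.refl

-- As `bs` does not start with `a`, the copies of `a` cannot merge with its first block, so they
-- form a block of their own.
runs-replicate : ∀ m a bs → ¬ StartsWith a bs →
                 runs (replicate (suc m) a ++ bs) ≡ (a ∷ replicate m a) ∷ runs bs
runs-replicate zero    a []       _ = ≡.refl
runs-replicate zero    a (b ∷ bs) ¬a with cs , ss , eq ← runs-∷ b bs =
  ≡.trans (≡.cong (consRun a) eq)
    (≡.trans (consRun-≢ cs ss λ a≡b → ¬a (≡.cong just (≡.sym a≡b)))
             (≡.cong ((a ∷ []) ∷_) (≡.sym eq)))
runs-replicate (suc m) a bs       ¬a =
  ≡.trans (≡.cong (consRun a) (runs-replicate m a bs ¬a)) (consRun-≡ a (replicate m a) (runs bs))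

module _ {r} (r≥1 : r ≥ 1) {a bs} (¬a : ¬ StartsWith a bs) where

  restricted-replicate⁻ : ∀ m → ¬ HasRun≥ r (replicate m a ++ bs) → m < r × ¬ HasRun≥ r bs
  -- With no copy of `a` there is no new block, and `0 < r` is the hypothesis itself.
  restricted-replicate⁻ zero    h = r≥1 , h
  restricted-replicate⁻ (suc m) h rewrite runs-replicate m a bs ¬a =
    ℕ.≰⇒> (λ r≤m → h (here (≡.subst (λ l → r ≤ suc l) (≡.sym (length-replicate m)) r≤m))) , h ∘ there

  restricted-replicate⁺ : ∀ m → m < r → ¬ HasRun≥ r bs → ¬ HasRun≥ r (replicate m a ++ bs)
  restricted-replicate⁺ zero    _   h = h
  restricted-replicate⁺ (suc m) m<r h rewrite runs-replicate m a bs ¬a = λ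
    { (here r≤m) → ℕ.<⇒≱ m<r (≡.subst (λ l → r ≤ suc l) (length-replicate m) r≤m)
    ; (there p)  → h p }

-- The normal form to which the two `restricted-replicate` lemmas apply; `m` is 0 when `as` does not
-- start with `a`.
leadingRun : ∀ a as → ∃₂ λ m bs → as ≡ replicate m a ++ bs × ¬ StartsWith a bs
leadingRun a []       = 0 , [] , ≡.refl , λ ()
leadingRun a (b ∷ as) with b ℕ.≟ a
... | no  b≢a    = 0 , b ∷ as , ≡.refl , b≢a ∘ just-injective
... | yes ≡.refl with m , bs , eq , ¬a ← leadingRun a as = suc m , bs , ≡.cong (a ∷_) eq , ¬a

-- Coefficients as cardinalities of classes of compositions.

-- A duplicate-free enumeration certifies that `z` is a cardinality. Identities between coefficients
-- thereby reduce to equivalences between predicates on compositions.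
record CountsAt (n k : ℕ) (P : List ℕ → Set) (z : ℤ) : Set where
  field
    members  : List (List ℕ)
    unique   : Unique members
    sound    : ∀ {as} → as ∈ members → IsComposition n k as × P as
    complete : ∀ {as} → IsComposition n k as → P as → as ∈ members
    size     : z ≡ + length members

open CountsAt

Counts : Series → (List ℕ → Set) → Set
Counts F P = ∀ n k → CountsAt n k P (F n k)

private variable
  n k : ℕ
  P Q : List ℕ → Set
  z w : ℤ

counts-resp : z ≡ w → (∀ {as} → P as → Q as) → (∀ {as} → Q as → P as) →
              CountsAt n k P z → CountsAt n k Q w
counts-resp z≡w to from c = record
  { members  = members c
  ; unique   = unique c
  ; sound    = λ m → proj₁ (sound c m) , to (proj₂ (sound c m))
  ; complete = λ comp p → complete c comp (from p)
  ; size     = ≡.trans (≡.sym z≡w) (size c)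
  }

-- Two duplicate-free lists with the same members are permutations of each other, hence equally
-- long.
counts-injective : CountsAt n k P z → CountsAt n k Q w →
                   (∀ {as} → IsComposition n k as → P as → Q as) →
                   (∀ {as} → IsComposition n k as → Q as → P as) → z ≡ w
counts-injective c d to from = ≡.trans (size c) (≡.trans
  (≡.cong +_ (↭-length (∼bag⇒↭ (unique∧set⇒bag (unique c) (unique d) (mk⇔
    (λ m → let comp , p = sound c m in complete d comp (to comp p))
    (λ m → let comp , p = sound d m in complete c comp (from comp p)))))))
  (≡.sym (size d)))

counts-∅ : (∀ {as} → IsComposition n k as → ¬ P as) → CountsAt n k P 0ℤ
counts-∅ none = record
  { members = [] ; unique = [] ; sound = λ () ; complete = λ comp p → ⊥-elim (none comp p) ; size = ≡.refl }

counts-⊎ : (∀ {as} → P as → ¬ Q as) → CountsAt n k P z → CountsAt n k Q w →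
           CountsAt n k (λ as → P as ⊎ Q as) (z ℤ.+ w)
counts-⊎ disjoint c d = record
  { members  = members c ++ members d
  ; unique   = Unique.++⁺ (unique c) (unique d)
                 λ (m , m′) → disjoint (proj₂ (sound c m)) (proj₂ (sound d m′))
  ; sound    = λ m → [ (λ m → let comp , p = sound c m in comp , inj₁ p)
                     , (λ m → let comp , p = sound d m in comp , inj₂ p) ]′ (∈-++⁻ (members c) m)
  ; complete = λ comp → [ ∈-++⁺ˡ ∘ complete c comp , ∈-++⁺ʳ (members c) ∘ complete d comp ]′
  ; size     = ≡.trans (≡.cong₂ ℤ._+_ (size c) (size d)) (≡.cong +_ (≡.sym (length-++ (members c))))
  }

counts-filter : (Q? : Decidable Q) (c : CountsAt n k P z) →
                CountsAt n k (λ as → P as × Q as) (+ length (filter Q? (members c)))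
counts-filter Q? c = record
  { members  = filter Q? (members c)
  ; unique   = Unique.filter⁺ Q? (unique c)
  ; sound    = λ m → let m′ , q = ∈-filter⁻ Q? {xs = members c} m
                         comp , p = sound c m′ in comp , p , q
  ; complete = λ comp (p , q) → ∈-filter⁺ Q? (complete c comp p) q
  ; size     = ≡.refl
  }

-- Induction on `N`: disjointness of the classes makes every further summand a disjoint union.
counts-sumTo : {P : ℕ → List ℕ → Set} {f : ℕ → ℤ} → (∀ {i j as} → P i as → P j as → i ≡ j) →
               (∀ i → CountsAt n k (P i) (f i)) →
               ∀ N → CountsAt n k (λ as → ∃ λ i → i ≤ N × P i as) (sumTo N f)
counts-sumTo {P = P} disjoint c zero =
  counts-resp ≡.refl (λ p → 0 , z≤n , p) (λ { (0 , z≤n , p) → p }) (c 0)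
counts-sumTo {P = P} disjoint c (suc N) = counts-resp ≡.refl to from
  (counts-⊎ (λ (i , i≤N , p) p′ → ℕ.<⇒≢ (s≤s i≤N) (disjoint p p′)) (counts-sumTo disjoint c N) (c (suc N)))
  where
  to : ∀ {as} → (∃ λ i → i ≤ N × P i as) ⊎ P (suc N) as → ∃ λ i → i ≤ suc N × P i as
  to (inj₁ (i , i≤N , p)) = i , ℕ.m≤n⇒m≤1+n i≤N , p
  to (inj₂ p)             = suc N , ℕ.≤-refl , p
  from : ∀ {as} → (∃ λ i → i ≤ suc N × P i as) → (∃ λ i → i ≤ N × P i as) ⊎ P (suc N) as
  from (i , i≤1+N , p) with ℕ.m≤n⇒m<n∨m≡n i≤1+N
  ... | inj₁ (s≤s i≤N) = inj₁ (i , i≤N , p)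
  ... | inj₂ ≡.refl    = inj₂ p

counts-one : Counts one (_≡ [])
counts-one zero zero = record
  { members = [] ∷ [] ; unique = [] ∷ [] ; sound = λ { (here ≡.refl) → ([] , ≡.refl , ≡.refl) , ≡.refl }
  ; complete = λ { _ ≡.refl → here ≡.refl } ; size = ≡.refl }
counts-one zero    (suc k) = counts-∅ λ { (_ , () , _) ≡.refl }
counts-one (suc n) k       = counts-∅ λ { (_ , _ , ()) ≡.refl }

-- Prepending parts as multiplication by monomials.

Prepended : List ℕ → (List ℕ → Set) → List ℕ → Set
Prepended ps P as = ∃ λ bs → as ≡ ps ++ bs × P bs

-- Deleting the leading `a` lowers the sum by `a` and the number of parts by 1, matching the shift
-- of coefficients by `q * x ^ a`.
counts-∷ : ∀ {F a} → a ≥ 1 → Counts F P → Counts (q * x ^ a * F) (Prepended (a ∷ []) P)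
counts-∷ {P} {F} {a} a≥1 c n k = counts-resp (≡.sym (𝕊.*-assoc q (x ^ a) F n k)) id id (shifted k)
  where
  shifted : ∀ k → CountsAt n k (Prepended (a ∷ []) P) ((q * (x ^ a * F)) n k)
  shifted zero = counts-resp (≡.sym (q*-zero (x ^ a * F) n)) id id
    (counts-∅ λ { (_ , () , _) (_ , ≡.refl , _) })
  shifted (suc k) with n ℕ.<? a
  -- A part larger than the whole sum is impossible, and the shifted coefficient vanishes as well.
  ... | yes n<a = counts-resp (≡.sym (≡.trans (q*-suc (x ^ a * F) n k) (x^*-< a F k n<a))) id id
    (counts-∅ λ { (_ , _ , ≡.refl) (bs , ≡.refl , _) → ℕ.<⇒≱ n<a (ℕ.m≤m+n a _) })
  ... | no  n≮a with m , ≡.refl ← ℕ.m≤n⇒∃[o]m+o≡n (ℕ.≮⇒≥ n≮a) = record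
    { members  = map (a ∷_) (members d)
    ; unique   = Unique.map⁺ ∷-injectiveʳ (unique d)
    ; sound    = λ m∈ → from (∈-map⁻ (a ∷_) m∈)
    ; complete = λ { ((_ ∷ pos) , len , s) (bs , ≡.refl , p) →
        ∈-map⁺ (a ∷_) (complete d (pos , ℕ.suc-injective len , ℕ.+-cancelˡ-≡ a _ _ s) p) }
    ; size     = ≡.trans (q*-suc (x ^ a * F) (a ℕ.+ m) k) (≡.trans (x^*-+ a F m k)
                   (≡.trans (size d) (≡.cong +_ (≡.sym (length-map (a ∷_) (members d))))))
    }
    where
    d = c m k
    from : ∀ {as} → (∃ λ bs → bs ∈ members d × as ≡ a ∷ bs) →
           IsComposition (a ℕ.+ m) (suc k) as × Prepended (a ∷ []) P as
    from (bs , bs∈ , ≡.refl) = let (pos , len , s) , p = sound d bs∈ in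
      (a≥1 ∷ pos , ≡.cong suc len , ≡.cong (a ℕ.+_) s) , bs , ≡.refl , p

-- Induction on `r`: each copy of `a` contributes one factor `q * x ^ a`, which `regroup` moves into
-- the powers.
counts-replicate : ∀ {F a} → a ≥ 1 → Counts F P → ∀ r →
                   Counts (q ^ r * x ^ (r ℕ.* a) * F) (Prepended (replicate r a) P)
counts-replicate {P} {F} a≥1 c zero n k = counts-resp
  (≡.sym (≡.trans (𝕊.*-assoc one one F n k)
    (≡.trans (𝕊.*-identityˡ (one * F) n k) (𝕊.*-identityˡ F n k))))
  (λ p → _ , ≡.refl , p) (λ { (_ , ≡.refl , p) → p }) (c n k)
counts-replicate {P} {F} {a} a≥1 c (suc r) n k = counts-resp
  (regroup n k)
  (λ { (_ , ≡.refl , bs , ≡.refl , p) → bs , ≡.refl , p })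
  (λ { (bs , ≡.refl , p) → _ , ≡.refl , bs , ≡.refl , p })
  (counts-∷ a≥1 (counts-replicate {F = F} a≥1 c r) n k)
  where
  regroup : q * x ^ a * (q ^ r * x ^ (r ℕ.* a) * F) ≈ q ^ suc r * x ^ (suc r ℕ.* a) * F
  regroup = begin
    q * x ^ a * (q ^ r * x ^ (r ℕ.* a) * F)
      ≈⟨ solve 5 (λ q y Q Y F → (q ⊕ y) ⊕ ((Q ⊕ Y) ⊕ F) ⊜ (q ⊕ Q) ⊕ (y ⊕ Y) ⊕ F) (λ _ _ → ≡.refl)
           q (x ^ a) (q ^ r) (x ^ (r ℕ.* a)) F ⟩
    q ^ suc r * (x ^ a * x ^ (r ℕ.* a) * F)
      ≈⟨ 𝕊.*-assoc (q ^ suc r) (x ^ a * x ^ (r ℕ.* a)) F ⟨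
    q ^ suc r * (x ^ a * x ^ (r ℕ.* a)) * F
      ≈⟨ 𝕊.*-congʳ {F} (𝕊.*-congˡ {q ^ suc r} (^-+ x a (r ℕ.* a))) ⟨
    q ^ suc r * x ^ (suc r ℕ.* a) * F ∎

-- The three relations for restricted compositions.

counts-generatingFunction : ∀ r → Counts (generatingFunction r) (λ as → ¬ HasRun≥ r as)
counts-generatingFunction r n k = record
  { members  = runRestricted n k r
  ; unique   = runRestricted-unique n k r
  ; sound    = ∈-runRestricted⁻
  ; complete = ∈-runRestricted⁺
  ; size     = ≡.refl
  }

startingWith notStartingWith : ℕ → ℕ → Series
startingWith    r a n k = + length (filter (startsWith? a) (runRestricted n k r))
notStartingWith r a n k = + length (filter (¬? ∘ startsWith? a) (runRestricted n k r))

counts-startingWith : ∀ r a → Counts (startingWith r a) (λ as → ¬ HasRun≥ r as × StartsWith a as)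
counts-startingWith r a n k = counts-filter (startsWith? a) (counts-generatingFunction r n k)

counts-notStartingWith : ∀ r a → Counts (notStartingWith r a) (λ as → ¬ HasRun≥ r as × ¬ StartsWith a as)
counts-notStartingWith r a n k = counts-filter (¬? ∘ startsWith? a) (counts-generatingFunction r n k)

generatingFunction-split : ∀ r a → generatingFunction r ≈ startingWith r a + notStartingWith r a
generatingFunction-split r a n k = counts-injective (counts-generatingFunction r n k)
  (counts-⊎ (λ (_ , s) (_ , ¬s) → ¬s s) (counts-startingWith r a n k) (counts-notStartingWith r a n k))
  (λ {as} _ → to as) (λ _ → [ proj₁ , proj₁ ]′)
  where
  to : ∀ as → ¬ HasRun≥ r as →
       (¬ HasRun≥ r as × StartsWith a as) ⊎ (¬ HasRun≥ r as × ¬ StartsWith a as)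
  to as h with startsWith? a as
  ... | yes s = inj₁ (h , s)
  ... | no ¬s = inj₂ (h , ¬s)

-- Prepending `a` to a restricted composition lengthens its leading run of `a` by one. The result is
-- either still restricted or has a leading run of exactly the forbidden length, followed by a
-- restricted rest not starting with `a`.
generatingFunction-prepend : ∀ {r a} → r ≥ 1 → a ≥ 1 → q * x ^ a * generatingFunction r ≈
  startingWith r a + q ^ r * x ^ (r ℕ.* a) * notStartingWith r a
generatingFunction-prepend {suc r} {a} r≥1 a≥1 n k = counts-injective
  (counts-∷ a≥1 (counts-generatingFunction (suc r)) n k)
  (counts-⊎ disjoint (counts-startingWith (suc r) a n k)
    (counts-replicate {F = notStartingWith (suc r) a} a≥1 (counts-notStartingWith (suc r) a) (suc r) n k))
  (λ _ → to) (λ _ → from)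
  where
  Starting Saturated : List ℕ → Set
  Starting as = ¬ HasRun≥ (suc r) as × StartsWith a as
  Saturated = Prepended (replicate (suc r) a) λ bs → ¬ HasRun≥ (suc r) bs × ¬ StartsWith a bs

  disjoint : ∀ {as} → Starting as → ¬ Saturated as
  disjoint (h , _) (bs , ≡.refl , _ , ¬a) = ℕ.n≮n _ (proj₁ (restricted-replicate⁻ r≥1 ¬a (suc r) h))

  to : ∀ {as} → Prepended (a ∷ []) (λ bs → ¬ HasRun≥ (suc r) bs) as → Starting as ⊎ Saturated as
  to (bs , ≡.refl , h) with m , cs , ≡.refl , ¬a ← leadingRun a bs
    -- The bound in force is `suc r`, so the leading run of `bs` has length `m ≤ r`. After
    -- prepending it stays below the bound if `m < r` and reaches it exactly if `m` is `r`.
    with s≤s m≤r , h′ ← restricted-replicate⁻ r≥1 ¬a m h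
    with ℕ.m≤n⇒m<n∨m≡n m≤r
  ... | inj₁ m<r    = inj₁ (restricted-replicate⁺ r≥1 ¬a (suc m) (s≤s m<r) h′ , ≡.refl)
  ... | inj₂ ≡.refl = inj₂ (cs , ≡.refl , h′ , ¬a)

  from : ∀ {as} → Starting as ⊎ Saturated as → Prepended (a ∷ []) (λ bs → ¬ HasRun≥ (suc r) bs) as
  -- The full leading run has length `suc m`; removing one copy shortens it to `m`, so the list
  -- stays restricted.
  from {b ∷ bs} (inj₁ (h , ≡.refl)) with m , cs , ≡.refl , ¬a ← leadingRun a bs =
    let m<r , h′ = restricted-replicate⁻ r≥1 ¬a (suc m) h
    in _ , ≡.refl , restricted-replicate⁺ r≥1 ¬a m (ℕ.<-trans (ℕ.n<1+n m) m<r) h′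
  from (inj₂ (bs , ≡.refl , h , ¬a)) = _ , ≡.refl , restricted-replicate⁺ r≥1 ¬a r (ℕ.n<1+n r) h

¬HasRun≥-[] : ∀ {r} → ¬ HasRun≥ r []
¬HasRun≥-[] ()

-- Classification by first part: the empty composition gives `one`, and a nonempty one lies in
-- exactly one class.
generatingFunction-total : ∀ r → generatingFunction r ≈ one + ∑[j≥1] (startingWith r)
generatingFunction-total r n k = counts-injective (counts-generatingFunction r n k)
  (counts-⊎ (λ { ≡.refl (_ , _ , _ , ()) }) (counts-one n k)
    (counts-sumTo (λ (_ , s) (_ , s′) → ℕ.suc-injective (just-injective (≡.trans (≡.sym s) s′)))
      (λ i → counts-startingWith r (suc i) n k) (n ℕ.+ k)))
  to (λ _ → [ (λ { ≡.refl → ¬HasRun≥-[] }) , (λ (_ , _ , h , _) → h) ]′)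
  where
  to : ∀ {as} → IsComposition n k as → ¬ HasRun≥ r as →
       as ≡ [] ⊎ ∃ λ i → i ≤ n ℕ.+ k × ¬ HasRun≥ r as × StartsWith (suc i) as
  to {[]}         _                h = inj₁ ≡.refl
  to {suc i ∷ as} (_ , _ , ≡.refl) h =
    -- The first part `suc i` is at most the sum `n`, so its index lies within the cutoff `n + k` of
    -- `∑`.
    inj₂ (i , ℕ.≤-trans (ℕ.n≤1+n i) (ℕ.≤-trans (ℕ.m≤m+n (suc i) _) (ℕ.m≤m+n _ k)) , h , ≡.refl)
  to {zero ∷ as}  (() ∷ _ , _)     h

theorem3 : (r : ℕ) → r ≥ 1 →
    generatingFunction r ≈
    one / (one - (x * q) / (one - x)
    + q ^ r * (∑[j≥1] λ j →
    (x ^ (r ℕ.* j) * (one - q * x ^ j)) / (one - q ^ r * x ^ (r ℕ.* j))))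
-- Composing with `suc` lets the index run over all positive parts; `denominator r` unfolds to the
-- displayed denominator.
theorem3 r r≥1 = quotient r≥1 {A = startingWith r ∘ suc} {H = notStartingWith r ∘ suc}
  (λ j → generatingFunction-split r (suc j))
  (λ j → generatingFunction-prepend r≥1 (s≤s z≤n))
  (generatingFunction-total r)
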